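{- For every partition $\lambda$ and every positive integer $n$, the polynomial $G_\lambda(\mathbf{x}_n;\mathbf{1};\mathbf{1})$ (the hybrid Grothendieck polynomial of straight shape $\lambda$ with all $t_i=w_i=1$ and $x_k=0$ for $k>n$) has saturated Newton polytope. Equivalently, regarding $G_\lambda(\mathbf{x}_n;\mathbf{t};\mathbf{w})$ as a polynomial in $x_1,\ldots,x_n$ with coefficients depending on generic parameters $\mathbf{t},\mathbf{w}$, it has saturated Newton polytope.
   Context: Boxes are $(i,j)$ (row $i$, column $j$). An SVRPP of shape $\lambda$ (a partition) is a filling $T$ assigning a nonempty finite set $T(i,j)$ of positive integers to each box of the Young diagram of $\lambda$ such that sets weakly increase along rows and down columns, where $A\le B$ means $\max A\le\min B$. $\mathrm{SVRPP}^n(\lambda)$: those with all sets contained in $\{1,\ldots,n\}$. $\mathrm{ircont}(T)=(r_1,r_2,\ldots)$ with $r_k$ the number of columns containing a box whose set contains $k$; $\mathrm{ceq}(T)=(c_1,\ldots)$ with $c_i$ the number of boxes $(i,j)$ with $(i+1,j)$ in the diagram and $\max T(i,j)=\min T(i+1,j)$; $\mathrm{ex}(T)=(e_1,\ldots)$ with $e_i=\sum_j(|T(i,j)|-1)$ over boxes of row $i$. $G_\lambda(\mathbf{x}_n;\mathbf{t};\mathbf{w})=\sum_{T\in\mathrm{SVRPP}^n(\lambda)}\mathbf{x}^{\mathrm{ircont}(T)}\mathbf{t}^{\mathrm{ceq}(T)}\mathbf{w}^{\mathrm{ex}(T)}$ where $\mathbf{y}^\alpha=\prod_k y_k^{\alpha_k}$.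 The Newton polytope of a polynomial $f=\sum_{\gamma\in\mathbb{Z}_{\ge0}^n}c_\gamma\mathbf{x}_n^\gamma$ is the convex hull of $\{\gamma: c_\gamma\ne0\}$; $f$ has saturated Newton polytope (SNP) if every lattice point of its Newton polytope is some $\gamma$ with $c_\gamma\neq0$.
   Formalization: The Newton polytope is formed with convex combinations having rational rather than real weights (the same lattice points, by Carathéodory), and only the form with all t_i=w_i=1 is stated, not the equivalent one with generic t, w. -}

module Defs where

open import Data.Nat as ℕ using (ℕ; zero; suc; _≤_; _<_; _<ᵇ_)
open import Data.Bool using (Bool; true; false; _∧_; _∨_; if_then_else_)
open import Data.Fin using (Fin; toℕ)
open import Data.List using (List; []; _∷_; length; map; upTo; foldr)
open import Data.List.Relation.Unary.Linked using (Linked)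
open import Data.List.Relation.Unary.All using (All)
open import Data.Integer as ℤ using (ℤ; +_)
open import Data.Rational as ℚ using (ℚ; 0ℚ; 1ℚ)
open import Data.Product using (Σ; ∃; _×_; _,_)
open import Relation.Binary.PropositionalEquality using (_≡_)

-- A partition: a weakly decreasing list of natural numbers (zero parts are
-- allowed and contribute no boxes).
IsPartition : List ℕ → Set
IsPartition λ′ = Linked ℕ._≥_ λ′

row : List ℕ → ℕ → ℕ
row []       _       = 0
row (x ∷ _)  zero    = x
row (_ ∷ xs) (suc i) = row xs i

InDiagram : List ℕ → ℕ → ℕ → Set
InDiagram λ′ i j = j < row λ′ i

-- A filling with sets contained in {1,…,n}: T i j k = true iff the value
-- (toℕ k + 1) belongs to the set in box (i , j).  Values outside the diagram
-- are irrelevant.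
Filling : ℕ → Set
Filling n = ℕ → ℕ → Fin n → Bool

-- A ≤ B  (max A ≤ min B), for nonempty sets
SetLe : ∀ {n} → (Fin n → Bool) → (Fin n → Bool) → Set
SetLe A B = ∀ a b → A a ≡ true → B b ≡ true → toℕ a ≤ toℕ b

IsSVRPP : (n : ℕ) → List ℕ → Filling n → Set
IsSVRPP n λ′ T =
  (∀ i j → InDiagram λ′ i j → ∃ λ k → T i j k ≡ true)
  × (∀ i j → InDiagram λ′ i (suc j) → SetLe (T i j) (T i (suc j)))
  × (∀ i j → InDiagram λ′ (suc i) j → SetLe (T i j) (T (suc i) j))

anyL : List Bool → Bool
anyL = foldr _∨_ false

sumℕ : List ℕ → ℕ
sumℕ = foldr ℕ._+_ 0

colHas : ∀ {n} → List ℕ → Filling n → ℕ → Fin n → Bool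
colHas λ′ T j k = anyL (map (λ i → (j <ᵇ row λ′ i) ∧ T i j k) (upTo (length λ′)))

ircont : ∀ {n} → List ℕ → Filling n → Fin n → ℕ
ircont λ′ T k = sumℕ (map (λ j → if colHas λ′ T j k then 1 else 0) (upTo (row λ′ 0)))

-- Support of G_λ(x_n; 1; 1) = Σ_{T ∈ SVRPPⁿ(λ)} x^{ircont T}: all coefficients
-- are counts of fillings, so γ is in the support iff some T has ircont T = γ.
InSupportG : (n : ℕ) → List ℕ → (Fin n → ℤ) → Set
InSupportG n λ′ γ = Σ (Filling n) λ T → IsSVRPP n λ′ T × (∀ k → γ k ≡ + ircont λ′ T k)

sumℚ : List ℚ → ℚ
sumℚ = foldr ℚ._+_ 0ℚ

toℚ : ℤ → ℚ
toℚ z = z ℚ./ 1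

InConvexHull : ∀ {n} → ((Fin n → ℤ) → Set) → (Fin n → ℤ) → Set
InConvexHull {n} S γ =
  Σ (List ((Fin n → ℤ) × ℚ)) λ ps →
      All (λ { (v , μ) → S v × (0ℚ ℚ.≤ μ) }) ps
    × (sumℚ (map (λ { (_ , μ) → μ }) ps) ≡ 1ℚ)
    × (∀ k → toℚ (γ k) ≡ sumℚ (map (λ { (v , μ) → μ ℚ.* toℚ (v k) }) ps))

SNP : ∀ {n} → ((Fin n → ℤ) → Set) → Set
SNP {n} S = ∀ (γ : Fin n → ℤ) → InConvexHull S γ → S γ

{-# OPTIONS --safe #-}
module Submission where

open import Defs
open import Data.Nat using (ℕ; _≤_)
open import Data.List using (List)

open import Data.Bool using (Bool; true; false; _∧_; _∨_; if_then_else_)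
open import Data.Bool.Properties using (∧-conicalˡ; ∧-conicalʳ; ∨-zeroʳ; ∨-comm; ∨-assoc; ¬-not)
open import Data.Fin using (Fin; zero; suc; toℕ; fromℕ<)
open import Data.Fin.Properties using (toℕ-fromℕ<; toℕ<n)
open import Data.Integer as ℤ using (ℤ; +_)
import Data.Integer.Properties as ℤ
open import Data.List using ([]; _∷_; map; upTo; applyUpTo; length)
open import Data.List.Properties using (map-upTo)
open import Data.List.Relation.Unary.All as All using (All; []; _∷_)
open import Data.List.Relation.Unary.Linked using ([]; [-]; _∷_)
open import Data.Nat using (zero; suc; _+_; _∸_; _⊓_; _⊔_; _<_; _<ᵇ_; z≤n; s≤s; s≤s⁻¹; s<s⁻¹; _≤?_; _<?_)
open import Data.Nat.Properties
open import Data.Nat.Tactic.RingSolver using (solve-∀)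
open import Data.Product using (∃-syntax; _×_; _,_; proj₁; proj₂)
open import Data.Rational as ℚ using (ℚ; 0ℚ; 1ℚ)
import Data.Rational.Properties as ℚ
open import Data.Rational.Solver using (module +-*-Solver)
open import Data.Rational.Unnormalised as ℚᵘ using (mkℚᵘ; *≡*; *≤*)
import Data.Rational.Unnormalised.Properties as ℚᵘ
open import Data.Sum using (inj₁; inj₂)
open import Function using (_∘_; case_of_)
open import Relation.Nullary using (yes; no; contradiction)
open import Relation.Binary.PropositionalEquality

-- Let h 0 ≥ h 1 ≥ … be the row lengths, μ q = min_{i ≤ q} (h i + i) and F p = Σ_{q < p} μ q.
-- The exponents γ which occur are exactly the nonnegative integer vectors with Σ_k γ_k ≥ h 0 and
-- Σ_{k ∈ K} γ_k ≤ F |K| for every set K of letters.  These are linear inequalities, so they pass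
-- to convex hulls.  Both directions of the description go by removing the largest letter n.
--
-- If ν is the shape formed by the boxes containing a smaller letter, then n misses every column j
-- with h (i + 1) ≤ j < ν i − 1 for some i, and μ_ν q ≤ μ_h (q + 1) + (ν i ∸ (1 + h (i + 1))) at
-- i = q; summing over q gives F_ν p + γ_n ≤ F_h (p + 1).
--
-- Conversely, with g = γ_n and s the sum of the other exponents, put
-- μ′ q = min (g, μ (q + 1)) + (μ q ∸ g), so that Σ_{q < p} μ′ q = min (F p, F (p + 1) − g).  The
-- shape ν i = min (μ′ i ∸ i, s) admits g or more columns for the letter n; enlarging ν to h in the
-- columns before a suitable c ≤ s makes the number of columns containing n exactly g.

-- Finite sums and bounded disjunctions

Σ< : (ℕ → ℕ) → ℕ → ℕ
Σ< a zero    = 0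
Σ< a (suc n) = Σ< a n + a n

Σ<-mono : ∀ {a b} → (∀ i → a i ≤ b i) → ∀ n → Σ< a n ≤ Σ< b n
Σ<-mono a≤b zero    = z≤n
Σ<-mono a≤b (suc n) = +-mono-≤ (Σ<-mono a≤b n) (a≤b n)

true≡true-iff : ∀ {b c} → (b ≡ true → c ≡ true) → (c ≡ true → b ≡ true) → b ≡ c
true≡true-iff {true}  {true}  f g = refl
true≡true-iff {true}  {false} f g = sym (f refl)
true≡true-iff {false} {true}  f g = g refl
true≡true-iff {false} {false} f g = refl

∧-intro : ∀ {b c} → b ≡ true → c ≡ true → b ∧ c ≡ true
∧-intro refl refl = refl

<⇒<ᵇ≡true : ∀ {m n} → m < n → (m <ᵇ n) ≡ true
<⇒<ᵇ≡true {zero}  {suc n} _   = refl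
<⇒<ᵇ≡true {suc m} {suc n} m<n = <⇒<ᵇ≡true (s<s⁻¹ m<n)

<ᵇ≡true⇒< : ∀ m n → (m <ᵇ n) ≡ true → m < n
<ᵇ≡true⇒< zero    (suc n) _ = s≤s z≤n
<ᵇ≡true⇒< (suc m) (suc n) e = s≤s (<ᵇ≡true⇒< m n e)

any< : (ℕ → Bool) → ℕ → Bool
any< b zero    = false
any< b (suc n) = any< b n ∨ b n

any<-intro : ∀ b {i n} → i < n → b i ≡ true → any< b n ≡ true
any<-intro b {i} {suc n} i<1+n bi with m<1+n⇒m<n∨m≡n i<1+n
... | inj₁ i<n  rewrite any<-intro b i<n bi = refl
... | inj₂ refl rewrite bi = ∨-zeroʳ (any< b n)

any<-elim : ∀ b n → any< b n ≡ true → ∃[ i ] i < n × b i ≡ true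
any<-elim b (suc n) e with any< b n in eq
... | true  = let i , i<n , bi = any<-elim b n eq in i , m<n⇒m<1+n i<n , bi
... | false = n , ≤-refl , e

-- Counting

bit : Bool → ℕ
bit b = if b then 1 else 0

bit≤1 : ∀ b → bit b ≤ 1
bit≤1 true  = ≤-refl
bit≤1 false = z≤n

count : (ℕ → Bool) → ℕ → ℕ
count b = Σ< (bit ∘ b)

count-cong : ∀ {b c} → (∀ i → b i ≡ c i) → ∀ n → count b n ≡ count c n
count-cong b≗c zero    = refl
count-cong b≗c (suc n) = cong₂ _+_ (count-cong b≗c n) (cong bit (b≗c n))

count-mono : ∀ b {m n} → m ≤ n → count b m ≤ count b n
count-mono b {zero}  {n}     _   = z≤n
count-mono b {suc m} {suc n} m≤n with m≤n⇒m<n∨m≡n (s≤s⁻¹ m≤n)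
... | inj₁ m<n  = ≤-trans (count-mono b m<n) (m≤m+n _ _)
... | inj₂ refl = ≤-refl

count-lipschitz : ∀ b {m n} → m ≤ n → count b n ≤ count b m + (n ∸ m)
count-lipschitz b {m} {n} m≤n = subst (λ x → count b x ≤ count b m + (n ∸ m)) (m+[n∸m]≡n m≤n) (go (n ∸ m))
  where
  open ≤-Reasoning
  go : ∀ d → count b (m + d) ≤ count b m + d
  go zero    = ≤-reflexive (trans (cong (count b) (+-identityʳ m)) (sym (+-identityʳ _)))
  go (suc d) = begin
    count b (m + suc d)                ≡⟨ cong (count b) (+-suc m d) ⟩
    count b (m + d) + bit (b (m + d))  ≤⟨ +-mono-≤ (go d) (bit≤1 (b (m + d))) ⟩
    count b m + d + 1                  ≡⟨ +-assoc (count b m) d 1 ⟩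
    count b m + (d + 1)                ≡⟨ cong (_+_ (count b m)) (+-comm d 1) ⟩
    count b m + suc d                  ∎

count-none : ∀ b {m n} → (∀ i → m ≤ i → i < n → b i ≢ true) → count b n ≤ count b m
count-none b {m} {zero}  none = z≤n
count-none b {m} {suc n} none with m ≤? n
... | no m≰n = count-mono b (≰⇒> m≰n)
... | yes m≤n rewrite ¬-not (none n m≤n ≤-refl) | +-identityʳ (count b n)
  = count-none b (λ i m≤i i<n → none i m≤i (m<n⇒m<1+n i<n))

count-all : ∀ b {m n} → m ≤ n → (∀ i → m ≤ i → i < n → b i ≡ true) → count b m + n ≤ count b n + m
count-all b {m} {n} m≤n all with m≤n⇒m<n∨m≡n m≤n
count-all b {m} {n}     m≤n all | inj₂ refl = ≤-refl
count-all b {m} {suc n} _   all | inj₁ m<1+n rewrite all n (s≤s⁻¹ m<1+n) ≤-refl = begin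
  count b m + suc n      ≡⟨ +-suc _ n ⟩
  suc (count b m + n)    ≤⟨ s≤s (count-all b (s≤s⁻¹ m<1+n) (λ i m≤i i<n → all i m≤i (m<n⇒m<1+n i<n))) ⟩
  suc (count b n + m)    ≡⟨ cong (_+ m) (+-comm 1 (count b n)) ⟩
  count b n + 1 + m      ∎
  where open ≤-Reasoning

-- Used on the rows of a tableau, where the boxes holding a letter other than the largest form a
-- prefix; its length `v` is a row length of the smaller shape.
initial-segment : ∀ (b : ℕ → Bool) m → (∀ j → suc j < m → b (suc j) ≡ true → b j ≡ true) →
  ∃[ v ] (∀ j → j < v → j < m × b j ≡ true) × (∀ j → j < m → b j ≡ true → j < v)
initial-segment b zero    down = 0 , (λ _ ()) , λ _ ()
initial-segment b (suc m) down with b m in bm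
... | true  = suc m , (λ j j≤m → j≤m , all-true m bm ≤-refl j (s≤s⁻¹ j≤m)) , λ j j≤m _ → j≤m
  where
  all-true : ∀ k → b k ≡ true → k < suc m → ∀ j → j ≤ k → b j ≡ true
  all-true zero    bk _   zero z≤n = bk
  all-true (suc k) bk k<m j    j≤k with m≤n⇒m<n∨m≡n j≤k
  ... | inj₁ j<k  = all-true k (down k k<m bk) (<-trans (n<1+n k) k<m) j (s≤s⁻¹ j<k)
  ... | inj₂ refl = bk
... | false =
  let v , to , from = initial-segment b m (λ j j<m → down j (m<n⇒m<1+n j<m))
  in v , (λ j j<v → let j<m , bj = to j j<v in m<n⇒m<1+n j<m , bj) ,
     λ j j≤m bj → case m<1+n⇒m<n∨m≡n j≤m of λ where
       (inj₁ j<m)  → from j j<m bj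
       (inj₂ refl) → case trans (sym bm) bj of λ ()

-- `G` falls by at most one per step and so cannot jump over `g`; the search runs down from `s`.
discrete-ivt : ∀ (G : ℕ → ℕ) {g} s → g ≤ G 0 → G s ≤ g → (∀ c → G c ≤ suc (G (suc c))) →
  ∃[ c ] c ≤ s × G c ≡ g
discrete-ivt G s g≤G0 Gs≤g step with m≤n⇒m<n∨m≡n Gs≤g
... | inj₂ Gs≡g = s , ≤-refl , Gs≡g
discrete-ivt G zero    g≤G0 _ step | inj₁ Gs<g = contradiction g≤G0 (<⇒≱ Gs<g)
discrete-ivt G (suc s) g≤G0 _ step | inj₁ Gs<g =
  let c , c≤s , Gc≡g = discrete-ivt G s g≤G0 (≤-trans (step s) Gs<g) step in c , m≤n⇒m≤1+n c≤s , Gc≡g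

-- Subsets of {0,…,n−1}

-- The size `p` is an index because the bound on a sum of exponents depends on it alone. The
-- constructors decide on the largest element, the letter that the inductions remove.
data Subset : ℕ → ℕ → Set where
  []   : Subset 0 0
  skip : ∀ {n p} → Subset n p → Subset (suc n) p
  take : ∀ {n p} → Subset n p → Subset (suc n) (suc p)

Σ∈ : ∀ {n p} → Subset n p → (ℕ → ℕ) → ℕ
Σ∈ []               γ = 0
Σ∈ (skip u)         γ = Σ∈ u γ
Σ∈ (take {n = n} u) γ = Σ∈ u γ + γ n

none : ∀ n → Subset n 0
none zero    = []
none (suc n) = skip (none n)

full : ∀ n → Subset n n
full zero    = []
full (suc n) = take (full n)

Σ∈-empty : ∀ {n} (u : Subset n 0) γ → Σ∈ u γ ≡ 0
Σ∈-empty []       γ = refl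
Σ∈-empty (skip u) γ = Σ∈-empty u γ

Σ∈≤Σ∈-full : ∀ {n p} (u : Subset n p) γ → Σ∈ u γ ≤ Σ∈ (full n) γ
Σ∈≤Σ∈-full []       γ = z≤n
Σ∈≤Σ∈-full (skip u) γ = ≤-trans (Σ∈≤Σ∈-full u γ) (m≤m+n _ _)
Σ∈≤Σ∈-full (take u) γ = +-monoˡ-≤ _ (Σ∈≤Σ∈-full u γ)

Σ∈-cong : ∀ {n p} (u : Subset n p) {γ δ} → (∀ k → k < n → γ k ≡ δ k) → Σ∈ u γ ≡ Σ∈ u δ
Σ∈-cong []       γ≗δ = refl
Σ∈-cong (skip u) γ≗δ = Σ∈-cong u λ k k<n → γ≗δ k (m<n⇒m<1+n k<n)
Σ∈-cong (take u) γ≗δ = cong₂ _+_ (Σ∈-cong u λ k k<n → γ≗δ k (m<n⇒m<1+n k<n)) (γ≗δ _ ≤-refl)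

-- Capacities

Antitone : (ℕ → ℕ) → Set
Antitone h = ∀ i → h (suc i) ≤ h i

antitone-≤ : ∀ {h i j} → Antitone h → i ≤ j → h j ≤ h i
antitone-≤ {j = zero}  anti z≤n = ≤-refl
antitone-≤ {j = suc j} anti i≤j with m≤n⇒m<n∨m≡n i≤j
... | inj₁ i<j  = ≤-trans (anti j) (antitone-≤ anti (s≤s⁻¹ i<j))
... | inj₂ refl = ≤-refl

μ : (ℕ → ℕ) → ℕ → ℕ
μ h zero    = h 0
μ h (suc q) = μ h q ⊓ (h (suc q) + suc q)

capacity : (ℕ → ℕ) → ℕ → ℕ
capacity h = Σ< (μ h)

μ-antitone : ∀ h → Antitone (μ h)
μ-antitone h q = m⊓n≤m (μ h q) _

μ≤ : ∀ h q → μ h q ≤ h q + q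
μ≤ h zero    = m≤m+n (h 0) 0
μ≤ h (suc q) = m⊓n≤n (μ h q) _

-- With `μ-antitone` and `μ≤` this makes `μ h` the largest antitone function below `i ↦ h i + i`,
-- hence monotone in `h`.
μ-greatest : ∀ {a h} → Antitone a → (∀ i → a i ≤ h i + i) → ∀ q → a q ≤ μ h q
μ-greatest {h = h} anti a≤ zero    = ≤-trans (a≤ 0) (≤-reflexive (+-identityʳ (h 0)))
μ-greatest         anti a≤ (suc q) = ⊓-glb (≤-trans (anti q) (μ-greatest anti a≤ q)) (a≤ (suc q))

μ-mono : ∀ {ν h} → (∀ i → ν i ≤ h i) → ∀ q → μ ν q ≤ μ h q
μ-mono {ν} ν≤h = μ-greatest (μ-antitone ν) (λ i → ≤-trans (μ≤ ν i) (+-monoˡ-≤ i (ν≤h i)))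

-- The number of columns j with h (suc i) ≤ j and suc j < ν i: there, a letter exceeding all
-- the letters in the boxes of ν would have to sit to the left of such a box in its own row.
blocked : (h ν : ℕ → ℕ) → ℕ → ℕ
blocked h ν i = ν i ∸ suc (h (suc i))

-- Both terms of the minimum `μ h (suc q)` are compared with `μ ν q`: the first by monotonicity, the
-- second through `μ≤`, where `blocked` is the excess of `ν q` over `suc (h (suc q))`.
μ≤μ-suc+blocked : ∀ {h ν} → (∀ i → ν i ≤ h i) → ∀ q → μ ν q ≤ μ h (suc q) + blocked h ν q
μ≤μ-suc+blocked {h} {ν} ν≤h q = ≤-trans
  (⊓-glb (≤-trans (μ-mono ν≤h q) (m≤m+n _ _)) (begin
    μ ν q                                           ≤⟨ μ≤ ν q ⟩
    ν q + q                                         ≤⟨ +-monoˡ-≤ q (m≤n+m∸n (ν q) (suc (h (suc q)))) ⟩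
    suc (h (suc q)) + blocked h ν q + q             ≡⟨ shuffle (h (suc q)) (blocked h ν q) q ⟩
    h (suc q) + suc q + blocked h ν q               ∎))
  (≤-reflexive (sym (+-distribʳ-⊓ (blocked h ν q) (μ h q) (h (suc q) + suc q))))
  where
  open ≤-Reasoning
  shuffle : ∀ x e q → suc x + e + q ≡ x + suc q + e
  shuffle = solve-∀

-- Summing `μ≤μ-suc+blocked` shifts the index by one; `h 0` is the term `μ h 0` that the shift
-- leaves out.
capacity-step : ∀ {h ν} → (∀ i → ν i ≤ h i) → ∀ p →
  capacity ν p + h 0 ≤ capacity h (suc p) + Σ< (blocked h ν) p
capacity-step {h} ν≤h zero = ≤-reflexive (sym (+-identityʳ (h 0)))
capacity-step {h} {ν} ν≤h (suc p) = begin
  capacity ν p + μ ν p + h 0    ≡⟨ shuffle₁ (capacity ν p) (μ ν p) (h 0) ⟩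
  capacity ν p + h 0 + μ ν p    ≤⟨ +-mono-≤ (capacity-step ν≤h p) (μ≤μ-suc+blocked ν≤h p) ⟩
  capacity h (suc p) + Σ< (blocked h ν) p + (μ h (suc p) + blocked h ν p)
                                ≡⟨ shuffle₂ (capacity h (suc p)) _ _ _ ⟩
  capacity h (suc (suc p)) + Σ< (blocked h ν) (suc p) ∎
  where
  open ≤-Reasoning
  shuffle₁ : ∀ a b c → a + b + c ≡ a + c + b
  shuffle₁ = solve-∀
  shuffle₂ : ∀ a b c d → a + b + (c + d) ≡ a + c + (b + d)
  shuffle₂ = solve-∀

-- Counting columns between consecutive row lengths

-- Meant for `a = h (suc i)`, `x = h i` and `v = ν i`: of the columns from `a` to `x`, the first
-- `v ∸ suc a` are excluded. Keeping `a` and `x` on opposite sides avoids subtracting row lengths.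
count-gap-≤ : ∀ b {a v x} → a ≤ x → v ≤ x → (∀ j → a ≤ j → suc j < v → b j ≢ true) →
  count b x + (v ∸ suc a) + a ≤ count b a + x
count-gap-≤ b {a} {v} {x} a≤x v≤x gap with v ≤? suc a
... | yes v≤1+a rewrite m≤n⇒m∸n≡0 v≤1+a = begin
  count b x + 0 + a            ≡⟨ cong (_+ a) (+-identityʳ (count b x)) ⟩
  count b x + a                ≤⟨ +-monoˡ-≤ a (count-lipschitz b a≤x) ⟩
  count b a + (x ∸ a) + a      ≡⟨ +-assoc (count b a) _ a ⟩
  count b a + (x ∸ a + a)      ≡⟨ cong (_+_ (count b a)) (m∸n+n≡m a≤x) ⟩
  count b a + x                ∎
  where open ≤-Reasoning
count-gap-≤ b {a} {suc y} {x} a≤x y<x gap | no v≰1+a = begin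
  count b x + (y ∸ a) + a            ≡⟨ +-assoc (count b x) _ a ⟩
  count b x + (y ∸ a + a)            ≡⟨ cong (_+_ (count b x)) (m∸n+n≡m (≤-trans (n≤1+n a) (s≤s⁻¹ (≰⇒> v≰1+a)))) ⟩
  count b x + y                      ≤⟨ +-monoˡ-≤ y (count-lipschitz b y≤x) ⟩
  count b y + (x ∸ y) + y            ≡⟨ +-assoc (count b y) _ y ⟩
  count b y + (x ∸ y + y)            ≡⟨ cong (_+_ (count b y)) (m∸n+n≡m y≤x) ⟩
  count b y + x                      ≤⟨ +-monoˡ-≤ x (count-none b λ j a≤j j<y → gap j a≤j (s≤s j<y)) ⟩
  count b a + x                      ∎
  where
  open ≤-Reasoning
  y≤x = ≤-trans (n≤1+n y) y<x
count-gap-≤ b {v = zero} _ _ _ | no v≰1+a = contradiction z≤n v≰1+a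

-- The mirror bound: beyond the first `v ∸ suc a` columns from `a` on, all columns up to `x` are
-- counted.
count-gap-≥ : ∀ b {a v x} → a ≤ x → v ≤ x → (∀ j → a ≤ j → v ≤ suc j → j < x → b j ≡ true) →
  count b a + x ≤ count b x + (v ∸ suc a) + a
count-gap-≥ b {a} {v} {x} a≤x v≤x fill with v ≤? suc a
... | yes v≤1+a rewrite m≤n⇒m∸n≡0 v≤1+a | +-identityʳ (count b x) =
  count-all b a≤x λ j a≤j → fill j a≤j (≤-trans v≤1+a (s≤s a≤j))
count-gap-≥ b {a} {suc y} {x} a≤x y<x fill | no v≰1+a = begin
  count b a + x                ≤⟨ +-monoˡ-≤ x (count-mono b a≤y) ⟩
  count b y + x                ≤⟨ count-all b (≤-trans (n≤1+n y) y<x) (λ j y≤j → fill j (≤-trans a≤y y≤j) (s≤s y≤j)) ⟩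
  count b x + y                ≡⟨ cong (_+_ (count b x)) (m∸n+n≡m a≤y) ⟨
  count b x + (y ∸ a + a)      ≡⟨ +-assoc (count b x) _ a ⟨
  count b x + (y ∸ a) + a      ∎
  where
  open ≤-Reasoning
  a≤y = ≤-trans (n≤1+n a) (s≤s⁻¹ (≰⇒> v≰1+a))
count-gap-≥ b {v = zero} _ _ _ | no v≰1+a = contradiction z≤n v≰1+a

-- Telescopes `count-gap-≤`: the ranges from `h (suc i)` to `h i` with `i < k` partition the columns
-- from `h k` to `h 0`.
count+blocked≤ : ∀ b {h ν} → Antitone h → (∀ i → ν i ≤ h i) →
  (∀ i j → h (suc i) ≤ j → suc j < ν i → b j ≢ true) →
  ∀ k → count b (h 0) + Σ< (blocked h ν) k + h k ≤ count b (h k) + h 0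
count+blocked≤ b {h} anti ν≤h gap zero = ≤-reflexive (cong (_+ h 0) (+-identityʳ _))
count+blocked≤ b {h} {ν} anti ν≤h gap (suc k) = +-cancelʳ-≤ (h k) _ _ (begin
  count b (h 0) + (Σ< E k + E k) + h (suc k) + h k       ≡⟨ shuffle₁ (count b (h 0)) _ _ _ _ ⟩
  count b (h 0) + Σ< E k + h k + (E k + h (suc k))       ≤⟨ +-monoˡ-≤ _ (count+blocked≤ b anti ν≤h gap k) ⟩
  count b (h k) + h 0 + (E k + h (suc k))                ≡⟨ shuffle₂ (count b (h k)) _ _ _ ⟩
  count b (h k) + E k + h (suc k) + h 0                  ≤⟨ +-monoˡ-≤ _ (count-gap-≤ b (anti k) (ν≤h k) (gap k)) ⟩
  count b (h (suc k)) + h k + h 0                        ≡⟨ shuffle₃ (count b (h (suc k))) _ _ ⟩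
  count b (h (suc k)) + h 0 + h k                        ∎)
  where
  open ≤-Reasoning
  E = blocked h ν
  shuffle₁ : ∀ a b c d e → a + (b + c) + d + e ≡ a + b + e + (c + d)
  shuffle₁ = solve-∀
  shuffle₂ : ∀ a b c d → a + b + (c + d) ≡ a + c + d + b
  shuffle₂ = solve-∀
  shuffle₃ : ∀ a b c → a + b + c ≡ a + c + b
  shuffle₃ = solve-∀

≤count+blocked : ∀ b {h ν} → Antitone h → (∀ i → ν i ≤ h i) →
  (∀ i j → h (suc i) ≤ j → ν i ≤ suc j → j < h i → b j ≡ true) →
  ∀ k → count b (h k) + h 0 ≤ count b (h 0) + Σ< (blocked h ν) k + h k
≤count+blocked b {h} anti ν≤h fill zero = ≤-reflexive (cong (_+ h 0) (sym (+-identityʳ _)))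
≤count+blocked b {h} {ν} anti ν≤h fill (suc k) = +-cancelʳ-≤ (h k) _ _ (begin
  count b (h (suc k)) + h 0 + h k                        ≡⟨ shuffle₃ (count b (h (suc k))) _ _ ⟩
  count b (h (suc k)) + h k + h 0                        ≤⟨ +-monoˡ-≤ _ (count-gap-≥ b (anti k) (ν≤h k) (fill k)) ⟩
  count b (h k) + E k + h (suc k) + h 0                  ≡⟨ shuffle₂ (count b (h k)) _ _ _ ⟩
  count b (h k) + h 0 + (E k + h (suc k))                ≤⟨ +-monoˡ-≤ _ (≤count+blocked b anti ν≤h fill k) ⟩
  count b (h 0) + Σ< E k + h k + (E k + h (suc k))       ≡⟨ shuffle₁ (count b (h 0)) _ _ _ _ ⟩
  count b (h 0) + (Σ< E k + E k) + h (suc k) + h k       ∎)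
  where
  open ≤-Reasoning
  E = blocked h ν
  shuffle₁ : ∀ a b c d e → a + b + e + (c + d) ≡ a + (b + c) + d + e
  shuffle₁ = solve-∀
  shuffle₂ : ∀ a b c d → a + c + d + b ≡ a + b + (c + d)
  shuffle₂ = solve-∀
  shuffle₃ : ∀ a b c → a + b + c ≡ a + c + b
  shuffle₃ = solve-∀

-- Capacities after the removal of one exponent

peel : (ℕ → ℕ) → ℕ → ℕ → ℕ
peel h g q = (g ⊓ μ h (suc q)) + (μ h q ∸ g)

peel-antitone : ∀ h g → Antitone (peel h g)
peel-antitone h g q = +-mono-≤ (⊓-monoʳ-≤ g (μ-antitone h (suc q))) (∸-monoˡ-≤ g (μ-antitone h q))

peel≤μ : ∀ h g q → peel h g q ≤ μ h q
peel≤μ h g q = ≤-trans (+-monoˡ-≤ _ (⊓-monoʳ-≤ g (μ-antitone h q))) (≤-reflexive (m⊓n+n∸m≡n g (μ h q)))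

-- The value of the sum is `min (F p, F (p + 1) - g)` for `F = capacity h`, written without
-- subtraction. It telescopes by `min (g, x) + (x ∸ g) = x`, and `g ≤ h 0` starts it.
Σ<-peel : ∀ h {g} → g ≤ h 0 → ∀ p → Σ< (peel h g) p + g ≡ capacity h p + (g ⊓ μ h p)
Σ<-peel h g≤h0 zero = sym (m≤n⇒m⊓n≡m g≤h0)
Σ<-peel h {g} g≤h0 (suc p) = begin
  Σ< (peel h g) p + ((g ⊓ μ h (suc p)) + (μ h p ∸ g)) + g  ≡⟨ shuffle₁ (Σ< (peel h g) p) (g ⊓ μ h (suc p)) (μ h p ∸ g) g ⟩
  Σ< (peel h g) p + g + ((g ⊓ μ h (suc p)) + (μ h p ∸ g))  ≡⟨ cong (_+ peel h g p) (Σ<-peel h g≤h0 p) ⟩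
  capacity h p + (g ⊓ μ h p) + ((g ⊓ μ h (suc p)) + (μ h p ∸ g)) ≡⟨ shuffle₂ (capacity h p) (g ⊓ μ h p) (g ⊓ μ h (suc p)) (μ h p ∸ g) ⟩
  capacity h p + ((g ⊓ μ h p) + (μ h p ∸ g)) + (g ⊓ μ h (suc p)) ≡⟨ cong (λ x → capacity h p + x + (g ⊓ μ h (suc p))) (m⊓n+n∸m≡n g (μ h p)) ⟩
  capacity h p + μ h p + (g ⊓ μ h (suc p))                 ∎
  where
  open ≡-Reasoning
  shuffle₁ : ∀ a b c d → a + (b + c) + d ≡ a + d + (b + c)
  shuffle₁ = solve-∀
  shuffle₂ : ∀ a b c d → a + b + (c + d) ≡ a + (b + d) + c
  shuffle₂ = solve-∀

-- `μ h k ∸ g` serves as a potential: row `k` blocks at most as many columns as the potential drops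
-- from `k` to `suc k`.
Σ<-blocked-peel : ∀ {h g ν} → (∀ i → ν i ≤ peel h g i ∸ i) →
  ∀ k → Σ< (blocked h ν) k + (μ h k ∸ g) ≤ h 0 ∸ g
Σ<-blocked-peel ν≤ zero = ≤-refl
Σ<-blocked-peel {h} {g} {ν} ν≤ (suc k) = begin
  Σ< E k + E k + (μ h (suc k) ∸ g)      ≡⟨ +-assoc (Σ< E k) _ _ ⟩
  Σ< E k + (E k + (μ h (suc k) ∸ g))    ≤⟨ +-monoʳ-≤ (Σ< E k) (+-monoˡ-≤ _ E≤) ⟩
  Σ< E k + ((μ h k ∸ g) ∸ (μ h (suc k) ∸ g) + (μ h (suc k) ∸ g))
                                        ≡⟨ cong (_+_ (Σ< E k)) (m∸n+n≡m (∸-monoˡ-≤ g (μ-antitone h k))) ⟩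
  Σ< E k + (μ h k ∸ g)                  ≤⟨ Σ<-blocked-peel {h} {g} ν≤ k ⟩
  h 0 ∸ g                               ∎
  where
  open ≤-Reasoning
  E = blocked h ν
  μ≤′ : μ h (suc k) ≤ k + suc (h (suc k))
  μ≤′ = ≤-trans (μ≤ h (suc k)) (≤-reflexive (trans (+-suc _ k) (trans (cong suc (+-comm _ k)) (sym (+-suc k _)))))
  E≤ : E k ≤ (μ h k ∸ g) ∸ (μ h (suc k) ∸ g)
  E≤ = begin
    ν k ∸ suc (h (suc k))                 ≤⟨ ∸-monoˡ-≤ (suc (h (suc k))) (ν≤ k) ⟩
    peel h g k ∸ k ∸ suc (h (suc k))      ≡⟨ ∸-+-assoc (peel h g k) k _ ⟩
    peel h g k ∸ (k + suc (h (suc k)))    ≤⟨ ∸-monoʳ-≤ (peel h g k) μ≤′ ⟩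
    -- Splitting `μ h (suc k)` at `g` exposes the summand shared with `peel h g k`, which cancels.
    peel h g k ∸ μ h (suc k)              ≡⟨ cong (peel h g k ∸_) (m⊓n+n∸m≡n g (μ h (suc k))) ⟨
    peel h g k ∸ ((g ⊓ μ h (suc k)) + (μ h (suc k) ∸ g))
                                          ≡⟨ [m+n]∸[m+o]≡n∸o (g ⊓ μ h (suc k)) _ _ ⟩
    (μ h k ∸ g) ∸ (μ h (suc k) ∸ g)       ∎

-- Tableaux: entries 1,…,n are shifted to 0,…,n−1, and rows have lengths h 0 ≥ h 1 ≥ …

record SVRPP (n : ℕ) (h : ℕ → ℕ) (T : ℕ → ℕ → ℕ → Bool) : Set where
  field
    nonempty : ∀ {i j} → j < h i → ∃[ k ] k < n × T i j k ≡ true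
    rows     : ∀ {i j a b} → suc j < h i → a < n → b < n → T i j a ≡ true → T i (suc j) b ≡ true → a ≤ b
    columns  : ∀ {i j a b} → j < h (suc i) → a < n → b < n → T i j a ≡ true → T (suc i) j b ≡ true → a ≤ b
open SVRPP

-- The bounds `ℓ` on rows and `m` on columns stay fixed while the shape changes with each removed
-- letter, so contents of different shapes count over the same range.
module Content (ℓ m : ℕ) where

  record Shape (h : ℕ → ℕ) : Set where
    field
      antitone : Antitone h
      height   : ∀ {i j} → j < h i → i < ℓ
      width    : h 0 ≤ m
  open Shape

  h-ℓ≡0 : ∀ {h} → Shape h → h ℓ ≡ 0
  h-ℓ≡0 {h} sh with h ℓ in eq
  ... | zero  = refl
  ... | suc _ = contradiction (height sh (subst (0 <_) (sym eq) (s≤s z≤n))) (<-irrefl refl)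

  inColumn : (ℕ → ℕ) → (ℕ → ℕ → ℕ → Bool) → ℕ → ℕ → Bool
  inColumn h T k j = any< (λ i → (j <ᵇ h i) ∧ T i j k) ℓ

  content : (ℕ → ℕ) → (ℕ → ℕ → ℕ → Bool) → ℕ → ℕ
  content h T k = count (inColumn h T k) m

  inColumn-intro : ∀ {h T i j k} → Shape h → j < h i → T i j k ≡ true → inColumn h T k j ≡ true
  inColumn-intro sh j<hi t = any<-intro _ (height sh j<hi) (∧-intro (<⇒<ᵇ≡true j<hi) t)

  inColumn-elim : ∀ h T k {j} → inColumn h T k j ≡ true → ∃[ i ] j < h i × T i j k ≡ true
  inColumn-elim h T k {j} e =
    let i , _ , e′ = any<-elim (λ i → (j <ᵇ h i) ∧ T i j k) ℓ e
    in i , <ᵇ≡true⇒< j (h i) (∧-conicalˡ _ _ e′) , ∧-conicalʳ _ _ e′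

  inColumn-cong : ∀ {h ν T T′ k} → Shape h → Shape ν →
    (∀ {i j} → j < h i → T i j k ≡ true → j < ν i × T′ i j k ≡ true) →
    (∀ {i j} → j < ν i → T′ i j k ≡ true → j < h i × T i j k ≡ true) →
    ∀ j → inColumn h T k j ≡ inColumn ν T′ k j
  inColumn-cong {h} {ν} {T} {T′} {k} sh sν to from j = true≡true-iff
    (λ e → let i , p , q = inColumn-elim h T k e ; p′ , q′ = to p q in inColumn-intro {T = T′} sν p′ q′)
    (λ e → let i , p , q = inColumn-elim ν T′ k e ; p′ , q′ = from p q in inColumn-intro {T = T} sh p′ q′)

  -- Necessity

  -- The filling `T` itself is kept: lowering the bound from `suc n` to `n` is what erases the
  -- largest letter.
  record Restriction (n : ℕ) (h : ℕ → ℕ) (T : ℕ → ℕ → ℕ → Bool) : Set where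
    field
      ν       : ℕ → ℕ
      shape   : Shape ν
      ν≤h     : ∀ i → ν i ≤ h i
      svrpp   : SVRPP n ν T
      covers  : ∀ {i j k} → j < h i → k < n → T i j k ≡ true → j < ν i

  ≤-by-< : ∀ {a b} → (∀ j → j < a → j < b) → a ≤ b
  ≤-by-< {zero}  f = z≤n
  ≤-by-< {suc a} f = f a ≤-refl

  restrict : ∀ {n h T} → Shape h → SVRPP (suc n) h T → Restriction n h T
  restrict {n} {h} {T} sh sv = record
    { ν = ν ; shape = shape′ ; ν≤h = ν≤h′
    ; svrpp = record
      { nonempty = letter
      ; rows     = λ {i} j<νi a<n b<n → rows sv (<-≤-trans j<νi (ν≤h′ i)) (m<n⇒m<1+n a<n) (m<n⇒m<1+n b<n)
      ; columns  = λ {i} j<νi a<n b<n → columns sv (<-≤-trans j<νi (ν≤h′ (suc i))) (m<n⇒m<1+n a<n) (m<n⇒m<1+n b<n)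
      }
    ; covers = λ {i} {j} j<hi k<n t → proj₂ (proj₂ (segment i)) j j<hi (any<-intro (T i j) k<n t)
    }
    where
    small : ℕ → ℕ → Bool
    small i j = any< (T i j) n

    segment : ∀ i → _
    -- A small letter in box `suc j` bounds every letter of box `j`, so that box has a small letter
    -- too.
    segment i = initial-segment (small i) (h i) λ j 1+j<hi e →
      let b , b<n , tb  = any<-elim (T i (suc j)) n e
          a , a≤n , ta  = nonempty sv (<-trans (n<1+n j) 1+j<hi)
          a≤b = rows sv 1+j<hi a≤n (m<n⇒m<1+n b<n) ta tb
      in any<-intro (T i j) (≤-<-trans a≤b b<n) ta

    ν : ℕ → ℕ
    ν i = proj₁ (segment i)

    ν≤h′ : ∀ i → ν i ≤ h i
    ν≤h′ i = ≤-by-< λ j j<νi → proj₁ (proj₁ (proj₂ (segment i)) j j<νi)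

    letter : ∀ {i j} → j < ν i → ∃[ k ] k < n × T i j k ≡ true
    letter {i} {j} j<νi = any<-elim (T i j) n (proj₂ (proj₁ (proj₂ (segment i)) j j<νi))

    ν-antitone : Antitone ν
    ν-antitone i = ≤-by-< λ j j<ν →
      let b , b<n , tb = letter j<ν
          j<h = <-≤-trans j<ν (ν≤h′ (suc i))
          a , a≤n , ta = nonempty sv (<-≤-trans j<h (antitone sh i))
          a≤b = columns sv j<h a≤n (m<n⇒m<1+n b<n) ta tb
      in proj₂ (proj₂ (segment i)) j (<-≤-trans j<h (antitone sh i)) (any<-intro (T i j) (≤-<-trans a≤b b<n) ta)

    shape′ : Shape ν
    shape′ = record
      { antitone = ν-antitone
      ; height   = λ {i} j<νi → height sh (<-≤-trans j<νi (ν≤h′ i))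
      ; width    = ≤-trans (ν≤h′ 0) (width sh)
      }

  module _ {n h T} (sh : Shape h) (sv : SVRPP (suc n) h T) where
    open Restriction (restrict sh sv)

    content-restrict : ∀ k → k < n → content h T k ≡ content ν T k
    content-restrict k k<n = count-cong
      (inColumn-cong {T = T} {T′ = T} sh shape (λ j<hi t → covers j<hi k<n t , t) (λ {i} j<νi t → <-≤-trans j<νi (ν≤h i) , t)) m

    -- The largest letter avoids the blocked columns, whose ranges for different rows are disjoint,
    -- and there are `h 0` columns in all.
    top-content+blocked≤ : ∀ p → content h T n + Σ< (blocked h ν) p ≤ h 0
    top-content+blocked≤ p = +-cancelʳ-≤ (h p) _ _ (begin
      count b m + Σ< (blocked h ν) p + h p        ≤⟨ +-monoˡ-≤ (h p) (+-monoˡ-≤ _ (count-none b beyond)) ⟩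
      count b (h 0) + Σ< (blocked h ν) p + h p    ≤⟨ count+blocked≤ b (antitone sh) ν≤h gap p ⟩
      count b (h p) + h 0                         ≤⟨ +-monoˡ-≤ (h 0) (count-lipschitz b z≤n) ⟩
      h p + h 0                                   ≡⟨ +-comm (h p) (h 0) ⟩
      h 0 + h p                                   ∎)
      where
      open ≤-Reasoning
      b = inColumn h T n
      beyond : ∀ j → h 0 ≤ j → j < m → b j ≢ true
      beyond j h0≤j _ e = let i , j<hi , _ = inColumn-elim h T n e in
        <⇒≱ j<hi (≤-trans (antitone-≤ (antitone sh) z≤n) h0≤j)
      gap : ∀ i j → h (suc i) ≤ j → suc j < ν i → b j ≢ true
      gap i j h≤j 1+j<νi e with inColumn-elim h T n e
      ... | i′ , j<hi′ , t with i′ ≤? i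
      -- Column `j` has no box below row `i`, since `h (suc i) ≤ j`.
      ... | no i′≰i = <⇒≱ j<hi′ (≤-trans (antitone-≤ (antitone sh) (≰⇒> i′≰i)) h≤j)
      -- The box to the right of `(i′ , j)` lies in `ν` and so holds a letter below `n`.
      ... | yes i′≤i =
        let 1+j<νi′ = <-≤-trans 1+j<νi (antitone-≤ (antitone shape) i′≤i)
            c , c<n , tc = nonempty svrpp 1+j<νi′
        in <⇒≱ c<n (rows sv (<-≤-trans 1+j<νi′ (ν≤h i′)) ≤-refl (m<n⇒m<1+n c<n) t tc)

    -- The first-row boxes from column `ν 0` on hold only the largest letter, one column each.
    h0≤ν0+top-content : h 0 ≤ ν 0 + content h T n
    h0≤ν0+top-content = begin
      h 0                              ≤⟨ m≤n+m (h 0) (count b (ν 0)) ⟩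
      count b (ν 0) + h 0              ≤⟨ count-all b (ν≤h 0) new ⟩
      count b (h 0) + ν 0              ≡⟨ +-comm _ (ν 0) ⟩
      ν 0 + count b (h 0)              ≤⟨ +-monoʳ-≤ (ν 0) (count-mono b (width sh)) ⟩
      ν 0 + count b m                  ∎
      where
      open ≤-Reasoning
      b = inColumn h T n
      new : ∀ j → ν 0 ≤ j → j < h 0 → b j ≡ true
      new j ν0≤j j<h0 with nonempty sv j<h0
      ... | k , k≤n , t with m<1+n⇒m<n∨m≡n k≤n
      ... | inj₁ k<n  = contradiction (covers j<h0 k<n t) (≤⇒≯ ν0≤j)
      ... | inj₂ refl = inColumn-intro {T = T} sh j<h0 t

  h0≤Σcontent : ∀ n {h T} → Shape h → SVRPP n h T → h 0 ≤ Σ∈ (full n) (content h T)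
  h0≤Σcontent zero {h} sh sv with h 0 in eq
  ... | zero  = z≤n
  ... | suc _ with () ← proj₁ (proj₂ (nonempty sv {0} {0} (subst (0 <_) (sym eq) (s≤s z≤n))))
  h0≤Σcontent (suc n) {h} {T} sh sv = begin
    h 0                                              ≤⟨ h0≤ν0+top-content sh sv ⟩
    ν 0 + content h T n                              ≤⟨ +-monoˡ-≤ _ (h0≤Σcontent n shape svrpp) ⟩
    Σ∈ (full n) (content ν T) + content h T n        ≡⟨ cong (_+ _) (Σ∈-cong (full n) (content-restrict sh sv)) ⟨
    Σ∈ (full n) (content h T) + content h T n        ∎
    where
    open ≤-Reasoning
    open Restriction (restrict sh sv)

  -- Skipping the largest letter only shrinks the shape, and with it the capacity. Taking it uses
  -- columns that, together with the blocked ones, number at most `h 0`; `capacity-step` trades this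
  -- `h 0` for one more term of the capacity.
  Σcontent≤capacity : ∀ {n p} (u : Subset n p) {h T} → Shape h → SVRPP n h T →
    Σ∈ u (content h T) ≤ capacity h p
  Σcontent≤capacity [] sh sv = z≤n
  Σcontent≤capacity {p = p} (skip u) {h} {T} sh sv = begin
    Σ∈ u (content h T)      ≡⟨ Σ∈-cong u (content-restrict sh sv) ⟩
    Σ∈ u (content ν T)      ≤⟨ Σcontent≤capacity u shape svrpp ⟩
    capacity ν p            ≤⟨ Σ<-mono (μ-mono ν≤h) p ⟩
    capacity h p            ∎
    where
    open ≤-Reasoning
    open Restriction (restrict sh sv)
  Σcontent≤capacity {n = suc n} {p = suc p} (take u) {h} {T} sh sv = +-cancelʳ-≤ E _ _ (begin
    Σ∈ u (content h T) + content h T n + E    ≡⟨ +-assoc (Σ∈ u (content h T)) _ E ⟩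
    Σ∈ u (content h T) + (content h T n + E)  ≤⟨ +-mono-≤ (≤-reflexive (Σ∈-cong u (content-restrict sh sv))) (top-content+blocked≤ sh sv p) ⟩
    Σ∈ u (content ν T) + h 0                  ≤⟨ +-monoˡ-≤ (h 0) (Σcontent≤capacity u shape svrpp) ⟩
    capacity ν p + h 0                        ≤⟨ capacity-step ν≤h p ⟩
    capacity h (suc p) + E                    ∎)
    where
    open ≤-Reasoning
    open Restriction (restrict sh sv)
    E = Σ< (blocked h ν) p

  -- Sufficiency

  -- Boxes whose right and lower neighbours lie outside `ν`: the corners of `ν` and, for antitone
  -- `ν`, everything beyond it. A letter larger than all those in `ν` can go there.
  rim : (ℕ → ℕ) → ℕ → ℕ → Bool
  rim ν i j = (ν i <ᵇ suc (suc j)) ∧ (ν (suc i) <ᵇ suc j)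

  rim-intro : ∀ {ν i j} → ν i ≤ suc j → ν (suc i) ≤ j → rim ν i j ≡ true
  rim-intro p q = ∧-intro (<⇒<ᵇ≡true (s≤s p)) (<⇒<ᵇ≡true (s≤s q))

  rim-elim : ∀ ν i j → rim ν i j ≡ true → ν i ≤ suc j × ν (suc i) ≤ j
  rim-elim ν i j e = s≤s⁻¹ (<ᵇ≡true⇒< (ν i) (suc (suc j)) (∧-conicalˡ _ _ e)) ,
                     s≤s⁻¹ (<ᵇ≡true⇒< (ν (suc i)) (suc j) (∧-conicalʳ _ _ e))

  -- The rim is cast as a filling that ignores its letter, hence the dummy letter `0`.
  rimColumn : (h ν : ℕ → ℕ) → ℕ → Bool
  rimColumn h ν = inColumn h (λ i j _ → rim ν i j) 0

  -- The shape which agrees with h in the columns before c and with ν from column c on.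
  splice : (h ν : ℕ → ℕ) → ℕ → ℕ → ℕ
  splice h ν c i = h i ⊓ (ν i ⊔ c)

  splice-shape : ∀ {h ν} c → Shape h → Antitone ν → Shape (splice h ν c)
  splice-shape {h} {ν} c sh anti = record
    { antitone = λ i → ⊓-mono-≤ (antitone sh i) (⊔-monoˡ-≤ c (anti i))
    ; height   = λ {i} j<κi → height sh (<-≤-trans j<κi (m⊓n≤m (h i) _))
    ; width    = ≤-trans (m⊓n≤m (h 0) _) (width sh)
    }

  -- The values of `T` outside `κ` are arbitrary, so they are masked. The new letter goes on the rim
  -- from column `c` on.
  addLetter : (n c : ℕ) (ν κ : ℕ → ℕ) → (ℕ → ℕ → ℕ → Bool) → ℕ → ℕ → ℕ → Bool
  addLetter n c ν κ T i j k = if k <ᵇ n then (j <ᵇ κ i) ∧ T i j k else (c <ᵇ suc j) ∧ rim ν i j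

  n<ᵇn : ∀ n → (n <ᵇ n) ≡ false
  n<ᵇn zero    = refl
  n<ᵇn (suc n) = n<ᵇn n

  module _ {n c h ν T} (sh : Shape h) (ν-antitone : Antitone ν) (sv : SVRPP n (splice h ν c) T) where
    private
      κ  = splice h ν c
      T⁺ = addLetter n c ν κ T

    addLetter-top : ∀ i j → T⁺ i j n ≡ (c <ᵇ suc j) ∧ rim ν i j
    addLetter-top i j rewrite n<ᵇn n = refl

    addLetter-low : ∀ {k} i j → k < n → T⁺ i j k ≡ (j <ᵇ κ i) ∧ T i j k
    addLetter-low i j k<n rewrite <⇒<ᵇ≡true k<n = refl

    top-elim : ∀ i j → T⁺ i j n ≡ true → c ≤ j × ν i ≤ suc j × ν (suc i) ≤ j
    top-elim i j e =
      let e′ = trans (sym (addLetter-top i j)) e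
      in s≤s⁻¹ (<ᵇ≡true⇒< c (suc j) (∧-conicalˡ _ _ e′)) , rim-elim ν i j (∧-conicalʳ (c <ᵇ suc j) _ e′)

    low-elim : ∀ {k} i j → k < n → T⁺ i j k ≡ true → j < κ i × T i j k ≡ true
    low-elim i j k<n e =
      let e′ = trans (sym (addLetter-low i j k<n)) e
      in <ᵇ≡true⇒< j (κ i) (∧-conicalˡ _ _ e′) , ∧-conicalʳ _ _ e′

    low-intro : ∀ {k i j} → k < n → j < κ i → T i j k ≡ true → T⁺ i j k ≡ true
    low-intro {i = i} {j} k<n j<κi t = trans (addLetter-low i j k<n) (∧-intro (<⇒<ᵇ≡true j<κi) t)

    -- The right and lower neighbours of a box with the letter `n` lie outside `ν` and not before
    -- column `c`, hence outside `κ`; no smaller letter occurs there.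
    addLetter-svrpp : SVRPP (suc n) h T⁺
    addLetter-svrpp = record { nonempty = nonempty⁺ ; rows = rows⁺ ; columns = columns⁺ }
      where
      nonempty⁺ : ∀ {i j} → j < h i → ∃[ k ] k < suc n × T⁺ i j k ≡ true
      nonempty⁺ {i} {j} j<hi with j <? κ i
      ... | yes j<κi = let k , k<n , t = nonempty sv j<κi in k , m<n⇒m<1+n k<n , low-intro k<n j<κi t
      -- A box of `h` outside `κ` lies at or beyond both `ν i` and `c`, so it receives `n`.
      ... | no j≮κi  = n , ≤-refl , trans (addLetter-top i j)
        (∧-intro (<⇒<ᵇ≡true (s≤s (≤-trans (m≤n⊔m (ν i) c) ν⊔c≤j)))
                 (rim-intro {ν} (m≤n⇒m≤1+n ν≤j) (≤-trans (ν-antitone i) ν≤j)))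
        where
        ν⊔c≤j : ν i ⊔ c ≤ j
        ν⊔c≤j = ≮⇒≥ λ j<ν⊔c → j≮κi (⊓-glb j<hi j<ν⊔c)
        ν≤j = ≤-trans (m≤m⊔n (ν i) c) ν⊔c≤j

      rows⁺ : ∀ {i j a b} → suc j < h i → a < suc n → b < suc n → T⁺ i j a ≡ true → T⁺ i (suc j) b ≡ true → a ≤ b
      rows⁺ {i} {j} _ a≤n b≤n ta tb with m<1+n⇒m<n∨m≡n b≤n
      ... | inj₂ refl = s≤s⁻¹ a≤n
      ... | inj₁ b<n with low-elim i (suc j) b<n tb | m<1+n⇒m<n∨m≡n a≤n
      ... | j<κi , tb′ | inj₁ a<n  = rows sv j<κi a<n b<n (proj₂ (low-elim i j a<n ta)) tb′
      ... | j<κi , _   | inj₂ refl =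
        let c≤j , ν≤1+j , _ = top-elim i j ta
        in contradiction (⊔-lub ν≤1+j (m≤n⇒m≤1+n c≤j)) (<⇒≱ (<-≤-trans j<κi (m⊓n≤n (h i) _)))

      columns⁺ : ∀ {i j a b} → j < h (suc i) → a < suc n → b < suc n → T⁺ i j a ≡ true → T⁺ (suc i) j b ≡ true → a ≤ b
      columns⁺ {i} {j} _ a≤n b≤n ta tb with m<1+n⇒m<n∨m≡n b≤n
      ... | inj₂ refl = s≤s⁻¹ a≤n
      ... | inj₁ b<n with low-elim (suc i) j b<n tb | m<1+n⇒m<n∨m≡n a≤n
      ... | j<κi , tb′ | inj₁ a<n  = columns sv j<κi a<n b<n (proj₂ (low-elim i j a<n ta)) tb′
      ... | j<κi , _   | inj₂ refl =
        let c≤j , _ , ν≤j = top-elim i j ta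
        in contradiction (⊔-lub ν≤j c≤j) (<⇒≱ (<-≤-trans j<κi (m⊓n≤n (h (suc i)) _)))

    content-addLetter-low : ∀ k → k < n → content h T⁺ k ≡ content κ T k
    content-addLetter-low k k<n = count-cong
      (inColumn-cong {T = T⁺} {T′ = T} sh (splice-shape c sh ν-antitone)
        (λ {i} {j} _ t → low-elim i j k<n t)
        (λ {i} j<κi t → <-≤-trans j<κi (m⊓n≤m (h i) _) , low-intro k<n j<κi t)) m

    content-addLetter-top : content h T⁺ n ≡ count (λ j → (c <ᵇ suc j) ∧ rimColumn h ν j) m
    content-addLetter-top = count-cong (λ j → true≡true-iff
      (λ e → let i , j<hi , t = inColumn-elim h T⁺ n e
                 t′ = trans (sym (addLetter-top i j)) t
             in ∧-intro (∧-conicalˡ _ _ t′) (inColumn-intro {T = λ i j _ → rim ν i j} {k = 0} sh j<hi (∧-conicalʳ (c <ᵇ suc j) _ t′)))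
      (λ e → let i , j<hi , t = inColumn-elim h (λ i j _ → rim ν i j) 0 {j} (∧-conicalʳ (c <ᵇ suc j) _ e)
             in inColumn-intro {T = T⁺} sh j<hi (trans (addLetter-top i j) (∧-intro (∧-conicalˡ _ (rimColumn h ν j) e) t)))) m

  count-from : (ℕ → Bool) → ℕ → ℕ → ℕ
  count-from b c = count (λ j → (c <ᵇ suc j) ∧ b j)

  count-from-step : ∀ b c n → count-from b c n ≤ suc (count-from b (suc c) n)
  count-from-step b c n = begin
    count-from b c n                             ≤⟨ go n ⟩
    count-from b (suc c) n + bit (c <ᵇ n)        ≤⟨ +-monoʳ-≤ _ (bit≤1 (c <ᵇ n)) ⟩
    count-from b (suc c) n + 1                   ≡⟨ +-comm _ 1 ⟩
    suc (count-from b (suc c) n)                 ∎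
    where
    open ≤-Reasoning
    last : ∀ n → bit ((c <ᵇ suc n) ∧ b n) + bit (c <ᵇ n) ≤ bit ((c <ᵇ n) ∧ b n) + bit (c <ᵇ suc n)
    last n with c <ᵇ n in c<n
    ... | true rewrite <⇒<ᵇ≡true (m<n⇒m<1+n (<ᵇ≡true⇒< c n c<n)) = ≤-refl
    ... | false with c <ᵇ suc n
    ...   | true  rewrite +-identityʳ (bit (b n)) = bit≤1 (b n)
    ...   | false = z≤n
    -- The bit is one as soon as column `c`, the only one where the two counts can differ, has been
    -- passed.
    go : ∀ n → count-from b c n ≤ count-from b (suc c) n + bit (c <ᵇ n)
    go zero    = z≤n
    go (suc n) = +-cancelʳ-≤ (bit (c <ᵇ n)) _ _ (begin
      count-from b c n + x + y                   ≡⟨ +-assoc (count-from b c n) x y ⟩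
      count-from b c n + (x + y)                 ≤⟨ +-mono-≤ (go n) (last n) ⟩
      count-from b (suc c) n + y + (z + w)       ≡⟨ shuffle (count-from b (suc c) n) y z w ⟩
      count-from b (suc c) n + z + w + y         ∎)
      where
      x = bit ((c <ᵇ suc n) ∧ b n)
      y = bit (c <ᵇ n)
      z = bit ((c <ᵇ n) ∧ b n)
      w = bit (c <ᵇ suc n)
      shuffle : ∀ a y z w → a + y + (z + w) ≡ a + z + w + y
      shuffle = solve-∀

  -- Only columns from `c` up to `x` contribute; `c ⊔ x` covers the case `x < c`.
  count-from-≤ : ∀ b {c g x} → (∀ j → b j ≡ true → j < x) → x ≤ c + g → count-from b c m ≤ g
  count-from-≤ b {c} {g} {x} bounded x≤c+g = begin
    count-from b c m                         ≤⟨ count-none b′ {c ⊔ x} {m} (λ j y≤j _ e → <⇒≱ (bounded j (∧-conicalʳ (c <ᵇ suc j) _ e)) (≤-trans (m≤n⊔m c x) y≤j)) ⟩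
    count-from b c (c ⊔ x)                   ≤⟨ count-lipschitz b′ (m≤m⊔n c x) ⟩
    count-from b c c + (c ⊔ x ∸ c)           ≤⟨ +-mono-≤ (count-none b′ {0} {c} λ j _ j<c e → <⇒≱ j<c (s≤s⁻¹ (<ᵇ≡true⇒< c (suc j) (∧-conicalˡ _ (b j) e))))
                                                         (∸-monoˡ-≤ c (⊔-lub (m≤m+n c g) x≤c+g)) ⟩
    0 + (c + g ∸ c)                          ≡⟨ m+n∸m≡n c g ⟩
    g                                        ∎
    where
    open ≤-Reasoning
    b′ = λ j → (c <ᵇ suc j) ∧ b j

  -- Every column of `h` that is not blocked meets the rim in its bottom box, and `Σ<-blocked-peel`
  -- allows at most `h 0 ∸ g` blocked columns.
  ≤count-rimColumn : ∀ {h ν g} → Shape h → (∀ i → ν i ≤ h i) → (∀ i → ν i ≤ peel h g i ∸ i) → g ≤ h 0 →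
    g ≤ count (rimColumn h ν) m
  ≤count-rimColumn {h} {ν} {g} sh ν≤h ν≤peel g≤h0 = +-cancelʳ-≤ (h 0 ∸ g) _ _ (begin
    g + (h 0 ∸ g)                                  ≡⟨ m+[n∸m]≡n g≤h0 ⟩
    h 0                                            ≤⟨ m≤n+m (h 0) (count b (h ℓ)) ⟩
    count b (h ℓ) + h 0                            ≤⟨ ≤count+blocked b (antitone sh) ν≤h fill ℓ ⟩
    count b (h 0) + Σ< (blocked h ν) ℓ + h ℓ       ≡⟨ cong (_+_ (count b (h 0) + Σ< (blocked h ν) ℓ)) (h-ℓ≡0 sh) ⟩
    count b (h 0) + Σ< (blocked h ν) ℓ + 0         ≡⟨ +-identityʳ _ ⟩
    count b (h 0) + Σ< (blocked h ν) ℓ             ≤⟨ +-mono-≤ (count-mono b (width sh))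
                                                       (≤-trans (m≤m+n _ (μ h ℓ ∸ g)) (Σ<-blocked-peel {h} {g} ν≤peel ℓ)) ⟩
    count b m + (h 0 ∸ g)                          ∎)
    where
    open ≤-Reasoning
    b = rimColumn h ν
    fill : ∀ i j → h (suc i) ≤ j → ν i ≤ suc j → j < h i → b j ≡ true
    fill i j h≤j ν≤1+j j<hi = inColumn-intro {T = λ i j _ → rim ν i j} {k = 0} sh j<hi
      (rim-intro {ν} ν≤1+j (≤-trans (ν≤h (suc i)) h≤j))

  head≤Σ< : ∀ a p → a 0 ≤ Σ< a (suc p)
  head≤Σ< a zero    = ≤-refl
  head≤Σ< a (suc p) = ≤-trans (head≤Σ< a p) (m≤m+n _ _)

  -- The inductive step of sufficiency: the inequalities for `h` and `suc n` letters yield those for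
  -- a spliced shape and `n` letters, with exactly `g` columns for the top letter.
  module Step {n h γ} (sh : Shape h) (h0≤s+g : h 0 ≤ Σ∈ (full (suc n)) γ)
              (bounds : ∀ {p} (u : Subset (suc n) p) → Σ∈ u γ ≤ capacity h p) where
    private
      g = γ n
      s = Σ∈ (full n) γ

    -- Every column needs one of the remaining letters, so at most s columns may survive.
    ν : ℕ → ℕ
    ν i = (peel h g i ∸ i) ⊓ s

    ν≤h : ∀ i → ν i ≤ h i
    ν≤h i = ≤-trans (m⊓n≤m _ s) (≤-trans (∸-monoˡ-≤ i (≤-trans (peel≤μ h g i) (μ≤ h i))) (≤-reflexive (m+n∸n≡m (h i) i)))

    ν-antitone : Antitone ν
    ν-antitone i = ⊓-monoˡ-≤ s (∸-mono (peel-antitone h g i) (n≤1+n i))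

    g≤h0 : g ≤ h 0
    g≤h0 = ≤-trans (m≤n+m g _) (bounds (take (none n)))

    -- At `c = 0` at least `g` columns meet the rim. At `c = s` at most `h 0 ∸ s` remain, hence at
    -- most `g`.
    column-choice : ∃[ c ] c ≤ s × count-from (rimColumn h ν) c m ≡ g
    column-choice = discrete-ivt (λ c → count-from (rimColumn h ν) c m) s
      (≤count-rimColumn sh ν≤h (λ i → m⊓n≤m _ s) g≤h0)
      (count-from-≤ (rimColumn h ν) rimColumn-bounded h0≤s+g)
      (λ c → count-from-step (rimColumn h ν) c m)
      where
      rimColumn-bounded : ∀ j → rimColumn h ν j ≡ true → j < h 0
      rimColumn-bounded j e =
        let i , j<hi , _ = inColumn-elim h (λ i j _ → rim ν i j) 0 {j} e
        in <-≤-trans j<hi (antitone-≤ (antitone sh) z≤n)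

    -- The lower bound on the sum of the remaining exponents; this is why `c` must not exceed `s`.
    splice0≤ : ∀ {c} → c ≤ s → splice h ν c 0 ≤ s
    splice0≤ c≤s = ≤-trans (m⊓n≤n (h 0) _) (⊔-lub (m⊓n≤n _ s) c≤s)

    -- If the cut at `s` is effective, the first term of the capacity already reaches the full sum
    -- `s`. Otherwise `peel h g i ≤ κ i + i`, so `μ-greatest` puts `peel h g` below `μ κ`.
    splice-bounds : ∀ c {p} (u : Subset n p) → Σ∈ u γ ≤ capacity (splice h ν c) p
    splice-bounds c {zero}  u = ≤-reflexive (Σ∈-empty u γ)
    splice-bounds c {suc p} u = case peel h g 0 ≤? s of λ where
        (no s<peel)  → truncated (≰⇒≥ s<peel)
        (yes peel≤s) → untruncated peel≤s
      where
      open ≤-Reasoning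
      κ = splice h ν c
      ν≤κ : ∀ i → ν i ≤ κ i
      ν≤κ i = ⊓-glb (ν≤h i) (m≤m⊔n (ν i) c)

      truncated : s ≤ peel h g 0 → Σ∈ u γ ≤ capacity κ (suc p)
      truncated s≤peel = begin
        Σ∈ u γ               ≤⟨ Σ∈≤Σ∈-full u γ ⟩
        s                    ≡⟨ m≥n⇒m⊓n≡n s≤peel ⟨
        ν 0                  ≤⟨ ν≤κ 0 ⟩
        κ 0                  ≤⟨ head≤Σ< (μ κ) p ⟩
        capacity κ (suc p)   ∎

      untruncated : peel h g 0 ≤ s → Σ∈ u γ ≤ capacity κ (suc p)
      untruncated peel≤s = +-cancelʳ-≤ g _ _ (begin
        -- The two terms of the minimum come from `u` without and with the letter `n`.
        Σ∈ u γ + g                                  ≤⟨ ⊓-glb (+-monoˡ-≤ g (bounds (skip u))) (bounds (take u)) ⟩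
        (capacity h (suc p) + g) ⊓ (capacity h (suc p) + μ h (suc p))
                                                    ≡⟨ +-distribˡ-⊓ (capacity h (suc p)) g _ ⟨
        capacity h (suc p) + (g ⊓ μ h (suc p))      ≡⟨ Σ<-peel h g≤h0 (suc p) ⟨
        Σ< (peel h g) (suc p) + g                   ≤⟨ +-monoˡ-≤ g (Σ<-mono (μ-greatest (peel-antitone h g) peel≤κ) (suc p)) ⟩
        capacity κ (suc p) + g                      ∎)
        where
        peel≤κ : ∀ i → peel h g i ≤ κ i + i
        peel≤κ i = begin
          peel h g i               ≤⟨ m≤n+m∸n _ i ⟩
          i + (peel h g i ∸ i)     ≡⟨ +-comm i _ ⟩
          (peel h g i ∸ i) + i     ≡⟨ cong (_+ i) (m≤n⇒m⊓n≡m (≤-trans (m∸n≤m _ i) (≤-trans (antitone-≤ (peel-antitone h g) z≤n) peel≤s))) ⟨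
          ν i + i                  ≤⟨ +-monoˡ-≤ i (ν≤κ i) ⟩
          κ i + i                  ∎

  realise : ∀ n {h} → Shape h → ∀ γ → h 0 ≤ Σ∈ (full n) γ →
    (∀ {p} (u : Subset n p) → Σ∈ u γ ≤ capacity h p) →
    ∃[ T ] SVRPP n h T × (∀ k → k < n → content h T k ≡ γ k)
  realise zero sh γ h0≤0 _ = (λ _ _ _ → false) , record
    { nonempty = λ j<hi → contradiction (<-≤-trans j<hi (≤-trans (antitone-≤ (antitone sh) z≤n) h0≤0)) λ ()
    ; rows     = λ _ ()
    ; columns  = λ _ ()
    } , λ _ ()
  realise (suc n) {h} sh γ h0≤s+g bounds
    with c , c≤s , top≡g ← Step.column-choice sh h0≤s+g bounds
    with T , sv , low≡γ  ← realise n (splice-shape c sh (Step.ν-antitone sh h0≤s+g bounds)) γ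
                             (Step.splice0≤ sh h0≤s+g bounds c≤s) (Step.splice-bounds sh h0≤s+g bounds c)
    = addLetter n c ν (splice h ν c) T , addLetter-svrpp sh ν-antitone sv , λ k k≤n →
      case m<1+n⇒m<n∨m≡n k≤n of λ where
        (inj₁ k<n)  → trans (content-addLetter-low sh ν-antitone sv k k<n) (low≡γ k k<n)
        (inj₂ refl) → trans (content-addLetter-top sh ν-antitone sv) top≡g
    where open Step sh h0≤s+g bounds using (ν; ν-antitone)

-- Linear inequalities on convex hulls

-- `mkℚᵘ z 0` is `z` over one: the second field is the denominator minus one. Unnormalised rationals
-- avoid the reduction to lowest terms.
toℚᵘ-toℚ : ∀ z → ℚ.toℚᵘ (toℚ z) ℚᵘ.≃ mkℚᵘ z 0
toℚᵘ-toℚ z = ℚ.toℚᵘ-fromℚᵘ (mkℚᵘ z 0)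

toℚ-homo-+ : ∀ a b → toℚ (a ℤ.+ b) ≡ toℚ a ℚ.+ toℚ b
toℚ-homo-+ a b = ℚ.toℚᵘ-injective (begin-equality
  ℚ.toℚᵘ (toℚ (a ℤ.+ b))                     ≃⟨ toℚᵘ-toℚ (a ℤ.+ b) ⟩
  mkℚᵘ (a ℤ.+ b) 0                           ≃⟨ *≡* (cong (ℤ._* + 1) (cong₂ ℤ._+_ (sym (ℤ.*-identityʳ a)) (sym (ℤ.*-identityʳ b)))) ⟩
  mkℚᵘ a 0 ℚᵘ.+ mkℚᵘ b 0                     ≃⟨ ℚᵘ.+-cong (toℚᵘ-toℚ a) (toℚᵘ-toℚ b) ⟨
  ℚ.toℚᵘ (toℚ a) ℚᵘ.+ ℚ.toℚᵘ (toℚ b)         ≃⟨ ℚ.toℚᵘ-homo-+ (toℚ a) (toℚ b) ⟨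
  ℚ.toℚᵘ (toℚ a ℚ.+ toℚ b)                   ∎)
  where open ℚᵘ.≤-Reasoning

toℚ-homo-* : ∀ a b → toℚ (a ℤ.* b) ≡ toℚ a ℚ.* toℚ b
toℚ-homo-* a b = ℚ.toℚᵘ-injective (begin-equality
  ℚ.toℚᵘ (toℚ (a ℤ.* b))                     ≃⟨ toℚᵘ-toℚ (a ℤ.* b) ⟩
  mkℚᵘ a 0 ℚᵘ.* mkℚᵘ b 0                     ≃⟨ ℚᵘ.*-cong (toℚᵘ-toℚ a) (toℚᵘ-toℚ b) ⟨
  ℚ.toℚᵘ (toℚ a) ℚᵘ.* ℚ.toℚᵘ (toℚ b)         ≃⟨ ℚ.toℚᵘ-homo-* (toℚ a) (toℚ b) ⟨
  ℚ.toℚᵘ (toℚ a ℚ.* toℚ b)                   ∎)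
  where open ℚᵘ.≤-Reasoning

toℚ-mono-≤ : ∀ {a b} → a ℤ.≤ b → toℚ a ℚ.≤ toℚ b
toℚ-mono-≤ {a} {b} a≤b = ℚ.toℚᵘ-cancel-≤ (begin
  ℚ.toℚᵘ (toℚ a)   ≃⟨ toℚᵘ-toℚ a ⟩
  mkℚᵘ a 0         ≤⟨ *≤* (ℤ.*-monoʳ-≤-nonNeg (+ 1) a≤b) ⟩
  mkℚᵘ b 0         ≃⟨ toℚᵘ-toℚ b ⟨
  ℚ.toℚᵘ (toℚ b)   ∎)
  where open ℚᵘ.≤-Reasoning

toℚ-cancel-≤ : ∀ {a b} → toℚ a ℚ.≤ toℚ b → a ℤ.≤ b
toℚ-cancel-≤ {a} {b} a≤b = subst₂ ℤ._≤_ (ℤ.*-identityʳ a) (ℤ.*-identityʳ b) (ℚᵘ.drop-*≤* (begin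
  mkℚᵘ a 0         ≃⟨ toℚᵘ-toℚ a ⟨
  ℚ.toℚᵘ (toℚ a)   ≤⟨ ℚ.toℚᵘ-mono-≤ a≤b ⟩
  ℚ.toℚᵘ (toℚ b)   ≃⟨ toℚᵘ-toℚ b ⟩
  mkℚᵘ b 0         ∎))
  where open ℚᵘ.≤-Reasoning

average : ∀ {V : Set} → List (V × ℚ) → (V → ℚ) → ℚ
average []             φ = 0ℚ
average ((v , c) ∷ ps) φ = c ℚ.* φ v ℚ.+ average ps φ

-- The summand is an arbitrary `F`, compared pointwise, because distinct pattern-matching lambdas
-- are not definitionally equal.
sumℚ-map≡average : ∀ {V : Set} (F : V × ℚ → ℚ) (φ : V → ℚ) → (∀ v c → F (v , c) ≡ c ℚ.* φ v) →
  ∀ ps → sumℚ (map F ps) ≡ average ps φ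
sumℚ-map≡average F φ F≗ []             = refl
sumℚ-map≡average F φ F≗ ((v , c) ∷ ps) = cong₂ ℚ._+_ (F≗ v c) (sumℚ-map≡average F φ F≗ ps)

average-zero : ∀ {V : Set} (ps : List (V × ℚ)) → average ps (λ _ → 0ℚ) ≡ 0ℚ
average-zero []             = refl
average-zero ((v , c) ∷ ps) = cong₂ ℚ._+_ (ℚ.*-zeroʳ c) (average-zero ps)

average-linear : ∀ {V : Set} w (φ ψ : V → ℚ) ps →
  w ℚ.* average ps φ ℚ.+ average ps ψ ≡ average ps (λ v → w ℚ.* φ v ℚ.+ ψ v)
average-linear w φ ψ [] = trans (ℚ.+-identityʳ _) (ℚ.*-zeroʳ w)
average-linear w φ ψ ((v , c) ∷ ps) = trans
  (shuffle w c (φ v) (ψ v) (average ps φ) (average ps ψ))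
  (cong (c ℚ.* (w ℚ.* φ v ℚ.+ ψ v) ℚ.+_) (average-linear w φ ψ ps))
  where
  open +-*-Solver
  shuffle : ∀ w c x y a b → w ℚ.* (c ℚ.* x ℚ.+ a) ℚ.+ (c ℚ.* y ℚ.+ b) ≡ c ℚ.* (w ℚ.* x ℚ.+ y) ℚ.+ (w ℚ.* a ℚ.+ b)
  shuffle = solve 6 (λ w c x y a b → w :* (c :* x :+ a) :+ (c :* y :+ b) := c :* (w :* x :+ y) :+ (w :* a :+ b)) refl

average-cong : ∀ {V : Set} {φ ψ : V → ℚ} → (∀ v → φ v ≡ ψ v) → ∀ ps → average ps φ ≡ average ps ψ
average-cong φ≗ψ []             = refl
average-cong φ≗ψ ((v , c) ∷ ps) = cong₂ (λ x y → c ℚ.* x ℚ.+ y) (φ≗ψ v) (average-cong φ≗ψ ps)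

average-mono : ∀ {V : Set} {φ ψ : V → ℚ} {ps} → All (λ (v , c) → 0ℚ ℚ.≤ c × φ v ℚ.≤ ψ v) ps →
  average ps φ ℚ.≤ average ps ψ
average-mono [] = ℚ.≤-refl
average-mono {ps = (v , c) ∷ ps} ((0≤c , φ≤ψ) ∷ rest) =
  ℚ.+-mono-≤ (ℚ.*-monoˡ-≤-nonNeg c {{ℚ.nonNegative 0≤c}} φ≤ψ) (average-mono rest)

linear : ∀ {n} → List (ℤ × Fin n) → (Fin n → ℤ) → ℤ
linear []             v = + 0
linear ((w , k) ∷ ws) v = w ℤ.* v k ℤ.+ linear ws v

average-linear-form : ∀ {n} (γ : Fin n → ℤ) ps → (∀ k → toℚ (γ k) ≡ average ps (λ v → toℚ (v k))) →
  ∀ ws → toℚ (linear ws γ) ≡ average ps (λ v → toℚ (linear ws v))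
average-linear-form γ ps γ≡ []             = sym (average-zero ps)
average-linear-form γ ps γ≡ ((w , k) ∷ ws) = begin
  toℚ (w ℤ.* γ k ℤ.+ linear ws γ)                       ≡⟨ homo γ ⟩
  toℚ w ℚ.* toℚ (γ k) ℚ.+ toℚ (linear ws γ)             ≡⟨ cong₂ (λ x y → toℚ w ℚ.* x ℚ.+ y) (γ≡ k) (average-linear-form γ ps γ≡ ws) ⟩
  toℚ w ℚ.* average ps (λ v → toℚ (v k)) ℚ.+ average ps (λ v → toℚ (linear ws v))
                                                        ≡⟨ average-linear (toℚ w) _ _ ps ⟩
  average ps (λ v → toℚ w ℚ.* toℚ (v k) ℚ.+ toℚ (linear ws v))
                                                        ≡⟨ average-cong homo ps ⟨
  average ps (λ v → toℚ (w ℤ.* v k ℤ.+ linear ws v))    ∎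
  where
  open ≡-Reasoning
  homo : ∀ v → toℚ (w ℤ.* v k ℤ.+ linear ws v) ≡ toℚ w ℚ.* toℚ (v k) ℚ.+ toℚ (linear ws v)
  homo v = trans (toℚ-homo-+ (w ℤ.* v k) (linear ws v)) (cong (ℚ._+ toℚ (linear ws v)) (toℚ-homo-* w (v k)))

-- The value of a linear form at `γ` is the weighted average of its values at points of `S`.
hull-linear-≤ : ∀ {n} {S : (Fin n → ℤ) → Set} {γ} ws B → (∀ v → S v → linear ws v ℤ.≤ B) →
  InConvexHull S γ → linear ws γ ℤ.≤ B
hull-linear-≤ {γ = γ} ws B S≤B (ps , all , Σ≡1 , γ≡) = toℚ-cancel-≤ (begin
  toℚ (linear ws γ)                         ≡⟨ average-linear-form γ ps (λ k → trans (γ≡ k) (sumℚ-map≡average _ _ (λ _ _ → refl) ps)) ws ⟩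
  average ps (λ v → toℚ (linear ws v))      ≤⟨ average-mono (All.map (λ { {v , c} (Sv , 0≤c) → 0≤c , toℚ-mono-≤ (S≤B v Sv)}) all) ⟩
  average ps (λ _ → toℚ B)                  ≡⟨ average-cong (λ _ → sym (trans (ℚ.+-identityʳ _) (ℚ.*-identityʳ (toℚ B)))) ps ⟩
  -- This shape lets `average-linear` pull `B` out, leaving the total weight, which is one.
  average ps (λ _ → toℚ B ℚ.* 1ℚ ℚ.+ 0ℚ)    ≡⟨ average-linear (toℚ B) (λ _ → 1ℚ) (λ _ → 0ℚ) ps ⟨
  toℚ B ℚ.* average ps (λ _ → 1ℚ) ℚ.+ average ps (λ _ → 0ℚ)
                                            ≡⟨ cong₂ (λ x y → toℚ B ℚ.* x ℚ.+ y) average-one (average-zero ps) ⟩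
  toℚ B ℚ.* 1ℚ ℚ.+ 0ℚ                       ≡⟨ trans (ℚ.+-identityʳ _) (ℚ.*-identityʳ (toℚ B)) ⟩
  toℚ B                                     ∎)
  where
  open ℚ.≤-Reasoning
  average-one : average ps (λ _ → 1ℚ) ≡ 1ℚ
  average-one = trans (sym (sumℚ-map≡average _ (λ _ → 1ℚ) (λ _ c → sym (ℚ.*-identityʳ c)) ps)) Σ≡1

-- The coordinates stay in `Fin N` while the recursion descends through `n`.
constant : ∀ {N n p} → ℤ → Subset n p → n ≤ N → List (ℤ × Fin N)
constant w []       _   = []
constant w (skip u) n≤N = constant w u (<⇒≤ n≤N)
constant w (take u) n≤N = (w , fromℕ< n≤N) ∷ constant w u (<⇒≤ n≤N)

linear-constant : ∀ {N n p} w (u : Subset n p) (n≤N : n ≤ N) {v : Fin N → ℤ} {γ} →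
  (∀ k → v k ≡ + γ (toℕ k)) → linear (constant w u n≤N) v ≡ w ℤ.* + Σ∈ u γ
linear-constant w []       n≤N v≡γ = sym (ℤ.*-zeroʳ w)
linear-constant w (skip u) n≤N v≡γ = linear-constant w u (<⇒≤ n≤N) v≡γ
linear-constant w (take {n} u) n<N {v} {γ} v≡γ = begin
  w ℤ.* v (fromℕ< n<N) ℤ.+ linear (constant w u (<⇒≤ n<N)) v
    ≡⟨ cong₂ (λ x y → w ℤ.* x ℤ.+ y) (trans (v≡γ _) (cong (λ k → + γ k) (toℕ-fromℕ< n<N))) (linear-constant w u (<⇒≤ n<N) v≡γ) ⟩
  w ℤ.* + γ n ℤ.+ w ℤ.* + Σ∈ u γ    ≡⟨ ℤ.*-distribˡ-+ w (+ γ n) (+ Σ∈ u γ) ⟨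
  w ℤ.* + (γ n + Σ∈ u γ)            ≡⟨ cong (λ x → w ℤ.* + x) (+-comm (γ n) _) ⟩
  w ℤ.* + (Σ∈ u γ + γ n)            ∎
  where open ≡-Reasoning

-- Between fillings indexed by Fin n and fillings indexed by ℕ

extend : ∀ {A : Set} {n} → A → (Fin n → A) → ℕ → A
extend {n = zero}  d f _       = d
extend {n = suc n} d f zero    = f zero
extend {n = suc n} d f (suc k) = extend d (f ∘ suc) k

extend-toℕ : ∀ {A : Set} {n} d (f : Fin n → A) k → extend d f (toℕ k) ≡ f k
extend-toℕ d f zero    = refl
extend-toℕ d f (suc k) = extend-toℕ d (f ∘ suc) k

-- List folds split off the first index, `any<` the last; `Σ<-suc` does the same for sums.
any<-suc : ∀ b n → b 0 ∨ any< (b ∘ suc) n ≡ any< b (suc n)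
any<-suc b zero    = ∨-comm (b 0) false
any<-suc b (suc n) = trans (sym (∨-assoc (b 0) _ _)) (cong (_∨ b (suc n)) (any<-suc b n))

anyL-upTo : ∀ b n → anyL (map b (upTo n)) ≡ any< b n
anyL-upTo b n = trans (cong anyL (map-upTo b n)) (go b n)
  where
  go : ∀ b n → anyL (applyUpTo b n) ≡ any< b n
  go b zero    = refl
  go b (suc n) = trans (cong (b 0 ∨_) (go (b ∘ suc) n)) (any<-suc b n)

any<-cong : ∀ {b c} → (∀ i → b i ≡ c i) → ∀ n → any< b n ≡ any< c n
any<-cong b≗c zero    = refl
any<-cong b≗c (suc n) = cong₂ _∨_ (any<-cong b≗c n) (b≗c n)

Σ<-suc : ∀ a n → a 0 + Σ< (a ∘ suc) n ≡ Σ< a (suc n)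
Σ<-suc a zero    = +-comm (a 0) 0
Σ<-suc a (suc n) = trans (sym (+-assoc (a 0) _ _)) (cong (_+ a (suc n)) (Σ<-suc a n))

sumℕ-upTo : ∀ a n → sumℕ (map a (upTo n)) ≡ Σ< a n
sumℕ-upTo a n = trans (cong sumℕ (map-upTo a n)) (go a n)
  where
  go : ∀ a n → sumℕ (applyUpTo a n) ≡ Σ< a n
  go a zero    = refl
  go a (suc n) = trans (cong (_+_ (a 0)) (go (a ∘ suc) n)) (Σ<-suc a n)

row-antitone : ∀ {xs} → IsPartition xs → Antitone (row xs)
row-antitone []       i       = z≤n
row-antitone [-]      i       = z≤n
row-antitone (p ∷ ps) zero    = p
row-antitone (p ∷ ps) (suc i) = row-antitone ps i

row-height : ∀ xs {i j} → j < row xs i → i < length xs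
row-height (x ∷ xs) {zero}  _    = s≤s z≤n
row-height (x ∷ xs) {suc i} j<xs = s≤s (row-height xs j<xs)

-- Agreement is a hypothesis so that both directions are served: a given filling is extended by
-- `false`, a constructed one is restricted to `Fin n`.
module _ (xs : List ℕ) {n} {T : Filling n} {T′ : ℕ → ℕ → ℕ → Bool} (T′≡T : ∀ i j k → T′ i j (toℕ k) ≡ T i j k) where
  open Content (length xs) (row xs 0)

  ircont≡content : ∀ k → ircont xs T k ≡ content (row xs) T′ (toℕ k)
  ircont≡content k = trans (sumℕ-upTo _ (row xs 0)) (count-cong
    (λ j → trans (anyL-upTo _ (length xs))
                 (any<-cong (λ i → cong ((j <ᵇ row xs i) ∧_) (sym (T′≡T i j k))) (length xs)))
    (row xs 0))

  IsSVRPP⇒SVRPP : IsSVRPP n xs T → SVRPP n (row xs) T′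
  IsSVRPP⇒SVRPP (ne , rw , cl) = record
    { nonempty = λ {i} {j} j<hi → let k , t = ne i j j<hi in toℕ k , toℕ<n k , trans (T′≡T i j k) t
    ; rows     = λ {i} {j} j<hi a<n b<n ta tb → ordered a<n b<n (rw i j j<hi _ _ (fin a<n ta) (fin b<n tb))
    ; columns  = λ {i} {j} j<hi a<n b<n ta tb → ordered a<n b<n (cl i j j<hi _ _ (fin a<n ta) (fin b<n tb))
    }
    where
    fin : ∀ {i j a} (a<n : a < n) → T′ i j a ≡ true → T i j (fromℕ< a<n) ≡ true
    fin {i} {j} a<n t = trans (sym (T′≡T i j _)) (trans (cong (T′ i j) (toℕ-fromℕ< a<n)) t)
    ordered : ∀ {a b} (a<n : a < n) (b<n : b < n) → toℕ (fromℕ< a<n) ≤ toℕ (fromℕ< b<n) → a ≤ b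
    ordered a<n b<n = subst₂ _≤_ (toℕ-fromℕ< a<n) (toℕ-fromℕ< b<n)

  SVRPP⇒IsSVRPP : SVRPP n (row xs) T′ → IsSVRPP n xs T
  SVRPP⇒IsSVRPP sv =
    (λ i j j<hi → let k , k<n , t = nonempty sv j<hi
                  in fromℕ< k<n , trans (sym (T′≡T i j _)) (trans (cong (T′ i j) (toℕ-fromℕ< k<n)) t)) ,
    (λ i j j<hi a b ta tb → rows sv j<hi (toℕ<n a) (toℕ<n b) (trans (T′≡T i j a) ta) (trans (T′≡T i (suc j) b) tb)) ,
    (λ i j j<hi a b ta tb → columns sv j<hi (toℕ<n a) (toℕ<n b) (trans (T′≡T i j a) ta) (trans (T′≡T (suc i) j b) tb))

-- Saturation from the linear description of the support

theorem1p4 : (λ′ : List ℕ) → IsPartition λ′ → (n : ℕ) → 1 ≤ n → SNP (InSupportG n λ′)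
theorem1p4 λ′ partition n _ γ hull =
  let T , sv , content≡ = realise n shape γ′ lower upper
  in (λ i j k → T i j (toℕ k)) , SVRPP⇒IsSVRPP λ′ {T′ = T} (λ _ _ _ → refl) sv ,
     λ k → trans (γ≡γ′ k) (cong +_ (trans (sym (content≡ (toℕ k) (toℕ<n k))) (sym (ircont≡content λ′ {T′ = T} (λ _ _ _ → refl) k))))
  where
  h = row λ′
  open Content (length λ′) (h 0)

  shape : Shape h
  shape = record { antitone = row-antitone partition ; height = row-height λ′ ; width = ≤-refl }

  support : ∀ {v} → InSupportG n λ′ v → ∃[ T ] SVRPP n h T × (∀ k → v k ≡ + content h T (toℕ k))
  support (T , sv , v≡) =
    (λ i j → extend false (T i j)) , IsSVRPP⇒SVRPP λ′ T′≡T sv ,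
    λ k → trans (v≡ k) (cong +_ (ircont≡content λ′ {T′ = λ i j → extend false (T i j)} T′≡T k))
    where
    T′≡T : ∀ i j k → extend false (T i j) (toℕ k) ≡ T i j k
    T′≡T i j = extend-toℕ false (T i j)

  -- Only upper bounds pass through `hull-linear-≤`, so lower bounds are stated for negated forms.
  γ≥0 : ∀ k → + 0 ℤ.≤ γ k
  γ≥0 k = ℤ.neg-cancel-≤ (subst (ℤ._≤ + 0) (-1*i+0 (γ k))
    (hull-linear-≤ {γ = γ} ((ℤ.-1ℤ , k) ∷ []) (+ 0) (λ v Sv → let _ , _ , v≡ = support Sv in
      subst (ℤ._≤ + 0) (sym (-1*i+0 (v k))) (ℤ.neg-mono-≤ (subst (+ 0 ℤ.≤_) (sym (v≡ k)) (ℤ.+≤+ z≤n)))) hull))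
    where
    -1*i+0 : ∀ i → ℤ.-1ℤ ℤ.* i ℤ.+ + 0 ≡ ℤ.- i
    -1*i+0 i = trans (ℤ.+-identityʳ _) (ℤ.-1*i≡-i i)

  -- By `γ≥0` the absolute value changes nothing; the default `0` is for letters outside the range.
  γ′ : ℕ → ℕ
  γ′ = extend 0 (λ k → ℤ.∣ γ k ∣)

  γ≡γ′ : ∀ k → γ k ≡ + γ′ (toℕ k)
  γ≡γ′ k = trans (sym (ℤ.0≤i⇒+∣i∣≡i (γ≥0 k))) (cong +_ (sym (extend-toℕ 0 (λ k → ℤ.∣ γ k ∣) k)))

  lower : h 0 ≤ Σ∈ (full n) γ′
  lower = ℤ.drop‿+≤+ (ℤ.neg-cancel-≤ (subst (ℤ._≤ ℤ.- (+ h 0)) (negated γ≡γ′)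
    (hull-linear-≤ {γ = γ} (constant ℤ.-1ℤ (full n) ≤-refl) (ℤ.- (+ h 0)) (λ v Sv → let _ , sv , v≡ = support Sv in
      subst (ℤ._≤ ℤ.- (+ h 0)) (sym (negated v≡)) (ℤ.neg-mono-≤ (ℤ.+≤+ (h0≤Σcontent n shape sv)))) hull)))
    where
    negated : ∀ {v δ} → (∀ k → v k ≡ + δ (toℕ k)) →
      linear (constant ℤ.-1ℤ (full n) ≤-refl) v ≡ ℤ.- (+ Σ∈ (full n) δ)
    negated v≡δ = trans (linear-constant ℤ.-1ℤ (full n) ≤-refl v≡δ) (ℤ.-1*i≡-i _)

  upper : ∀ {p} (u : Subset n p) → Σ∈ u γ′ ≤ capacity h p
  upper {p} u = ℤ.drop‿+≤+ (subst (ℤ._≤ + capacity h p) (unit γ≡γ′)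
    (hull-linear-≤ {γ = γ} (constant ℤ.1ℤ u ≤-refl) (+ capacity h p) (λ v Sv → let _ , sv , v≡ = support Sv in
      subst (ℤ._≤ + capacity h p) (sym (unit v≡)) (ℤ.+≤+ (Σcontent≤capacity u shape sv))) hull))
    where
    unit : ∀ {v δ} → (∀ k → v k ≡ + δ (toℕ k)) → linear (constant ℤ.1ℤ u ≤-refl) v ≡ + Σ∈ u δ
    unit v≡δ = trans (linear-constant ℤ.1ℤ u ≤-refl v≡δ) (ℤ.*-identityˡ _)
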